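{- Suppose $T$ is a countable complete theory with NIP, and let $\bar M$ be a saturated model of $T$. Let $M_0$ be a countable elementary substructure of $\bar M$. Let $p(x)$ be a complete $1$-type over $\bar M$ which is finitely satisfiable in $M_0$. Let $U=\{X\cap M_0: X\in p\}$. Then $U$ is a Borel (in fact an $F_\sigma$) subset of the Polish space $2^{M_0}$.
   Context: $\bar M$ is a large saturated model of $T$. $T$ has NIP if there is no formula $\phi(x,y)$ of the language together with $\langle a_i:i<\omega\rangle$ and $\langle b_w:w\subseteq\omega\rangle$ in $\bar M$ such that $\models\phi(a_i,b_w)$ iff $i\in w$. A complete type $p$ over $\bar M$ is identified with the family of definable (with parameters in $\bar M$) sets $X\subseteq\bar M$ whose defining formula belongs to $p$; thus "$X\in p$" means that the formula defining $X$ is in $p$. $p$ is finitely satisfiable in $M_0$ if every formula in $p$ is satisfied by an element of $M_0$. The power set of $M_0$ is identified with $2^{M_0}$ with the product topology. -}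

module Defs where

open import Level using (Level; suc)
open import Data.Bool.Base using (Bool; T)
open import Data.Fin.Base using (Fin)
open import Data.List.Base using (List)
open import Data.List.Relation.Unary.All using (All)
open import Data.Nat.Base as ℕ using (ℕ)
open import Data.Product.Base using (Σ; ∃; _×_)
open import Data.Sum.Base using (_⊎_)
open import Data.Vec.Base as Vec using (Vec; []; _∷_; _++_; lookup)
import Data.Vec.Relation.Unary.All as VecAll
open import Function.Bundles using (_⇔_; _↣_)
open import Function.Definitions using (Injective)
open import Relation.Binary.PropositionalEquality using (_≡_)
open import Relation.Nullary.Negation.Core using (¬_)
open import Relation.Unary using (Pred; _∈_; _≐_; ∁; ⋃)

private
  variable
    a ℓ : Level

Countable : Set a → Set a
Countable A = A ↣ ℕ

-- First-order logic with equality.  A formula in Formula L n has its free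
-- variables among n de Bruijn indices; ¬, ∧, ∃ are primitive and the other
-- connectives are abbreviations.

record Language (ℓ : Level) : Set (suc ℓ) where
  field
    Fun : ℕ → Set ℓ
    Rel : ℕ → Set ℓ

open Language public

CountableLanguage : Language ℓ → Set ℓ
CountableLanguage L = Countable (∃ (Fun L)) × Countable (∃ (Rel L))

data Term (L : Language ℓ) (n : ℕ) : Set ℓ where
  var : Fin n → Term L n
  app : ∀ {k} → Fun L k → Vec (Term L n) k → Term L n

infix  8 _≈̇_
infix  7 ¬̇_ ∃̇_
infixr 6 _∧̇_

data Formula (L : Language ℓ) : ℕ → Set ℓ where
  _≈̇_ : ∀ {n} → Term L n → Term L n → Formula L n
  rel : ∀ {n k} → Rel L k → Vec (Term L n) k → Formula L n
  ¬̇_  : ∀ {n} → Formula L n → Formula L n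
  _∧̇_ : ∀ {n} → Formula L n → Formula L n → Formula L n
  ∃̇_  : ∀ {n} → Formula L (ℕ.suc n) → Formula L n

Sentence : Language ℓ → Set ℓ
Sentence L = Formula L 0

Theory : Language ℓ → Set (suc ℓ)
Theory {ℓ} L = Pred (Sentence L) ℓ

record Structure {ℓ : Level} (L : Language ℓ) : Set (suc ℓ) where
  field
    Carrier  : Set ℓ
    nonempty : Carrier
    funᴵ     : ∀ {k} → Fun L k → Vec Carrier k → Carrier
    relᴵ     : ∀ {k} → Rel L k → Pred (Vec Carrier k) ℓ

open Structure public using () renaming (Carrier to ∣_∣)

module _ {L : Language ℓ} (M : Structure L) where
  open Structure M

  mutual
    eval : ∀ {n} → Vec Carrier n → Term L n → Carrier
    eval ρ (var i)    = lookup ρ i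
    eval ρ (app f ts) = funᴵ f (evals ρ ts)

    evals : ∀ {n k} → Vec Carrier n → Vec (Term L n) k → Vec Carrier k
    evals ρ []       = []
    evals ρ (t ∷ ts) = eval ρ t ∷ evals ρ ts

infix 4 _⊨_[_] _⊨_ _⊨ᵀ_

_⊨_[_] : {L : Language ℓ} (M : Structure L) {n : ℕ} →
         Formula L n → Vec ∣ M ∣ n → Set ℓ
M ⊨ (s ≈̇ t)  [ ρ ] = eval M ρ s ≡ eval M ρ t
M ⊨ rel R ts [ ρ ] = Structure.relᴵ M R (evals M ρ ts)
M ⊨ (¬̇ φ)    [ ρ ] = ¬ (M ⊨ φ [ ρ ])
M ⊨ (φ ∧̇ ψ)  [ ρ ] = (M ⊨ φ [ ρ ]) × (M ⊨ ψ [ ρ ])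
M ⊨ (∃̇ φ)    [ ρ ] = Σ ∣ M ∣ λ m → M ⊨ φ [ m ∷ ρ ]

_⊨_ : {L : Language ℓ} → Structure L → Sentence L → Set ℓ
M ⊨ σ = M ⊨ σ [ [] ]

_⊨ᵀ_ : {L : Language ℓ} → Structure L → Theory L → Set ℓ
M ⊨ᵀ T = ∀ σ → σ ∈ T → M ⊨ σ

-- "Complete" is taken semantically: T has a model, and it entails σ or ¬σ for
-- every sentence σ.

_⊩_ : {L : Language ℓ} → Theory L → Sentence L → Set (suc ℓ)
_⊩_ {L = L} T σ = (N : Structure L) → N ⊨ᵀ T → N ⊨ σ

CompleteTheory : {L : Language ℓ} → Theory L → Set (suc ℓ)
CompleteTheory {L = L} T =
  (Σ (Structure L) λ N → N ⊨ᵀ T) × (∀ σ → (T ⊩ σ) ⊎ (T ⊩ (¬̇ σ)))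

-- An elementary substructure is given through its inclusion map.  Applied to
-- the atomic formulas, `elementary` says that the inclusion is injective,
-- commutes with the function symbols, and preserves and reflects the relations.

record ElementarySubstructure {L : Language ℓ} (M : Structure L) : Set (suc ℓ) where
  field
    structure  : Structure L
    incl       : ∣ structure ∣ → ∣ M ∣
    elementary : ∀ {n} (φ : Formula L n) (ρ : Vec ∣ structure ∣ n) →
                 (structure ⊨ φ [ ρ ]) ⇔ (M ⊨ φ [ Vec.map incl ρ ])

open ElementarySubstructure public using (structure; incl)

-- A formula φ(x, b) in one free variable x (index 0) with parameters b from M.

record Formulaₓ {L : Language ℓ} (M : Structure L) : Set ℓ where
  constructor _⟨x,_⟩
  field
    {arity} : ℕ
    formula : Formula L (ℕ.suc arity)
    params  : Vec ∣ M ∣ arity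

open Formulaₓ public

module _ {L : Language ℓ} {M : Structure L} where

  negₓ : Formulaₓ M → Formulaₓ M
  negₓ (φ ⟨x, b ⟩) = (¬̇ φ) ⟨x, b ⟩

  ParamsIn : Pred ∣ M ∣ ℓ → Formulaₓ M → Set ℓ
  ParamsIn A φ = VecAll.All (_∈ A) (params φ)

  -- The definable set φ(M, b).
  ⟦_⟧ : Formulaₓ M → Pred ∣ M ∣ ℓ
  ⟦ φ ⟨x, b ⟩ ⟧ m = M ⊨ φ [ m ∷ b ]

-- Complete 1-types over a set A of parameters from M.  Consistency with the
-- elementary diagram of M over A is finite satisfiability in M.

record CompleteType {L : Language ℓ} (M : Structure L) (A : Pred ∣ M ∣ ℓ) : Set (suc ℓ) where
  field
    formulas   : Pred (Formulaₓ M) ℓ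
    over       : ∀ φ → φ ∈ formulas → ParamsIn A φ
    consistent : ∀ (Γ : List (Formulaₓ M)) → All (_∈ formulas) Γ →
                 ∃ λ m → All (λ φ → m ∈ ⟦ φ ⟧) Γ
    complete   : ∀ φ → ParamsIn A φ → φ ∈ formulas ⊎ negₓ φ ∈ formulas

open CompleteType public using (formulas)

Realises : {L : Language ℓ} {M : Structure L} {A : Pred ∣ M ∣ ℓ} →
           ∣ M ∣ → CompleteType M A → Set ℓ
Realises m p = ∀ φ → φ ∈ formulas p → m ∈ ⟦ φ ⟧

-- |A| < |X|: no injection of X into A.  It is phrased as a self-map of X with
-- values in A because Σ X A may count an element of A more than once.

Smaller : {X : Set ℓ} → Pred X ℓ → Set ℓ
Smaller {X = X} A =
  ¬ (Σ (X → X) λ f → Injective _≡_ _≡_ f × (∀ x → f x ∈ A))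

Saturated : {L : Language ℓ} → Structure L → Set (suc ℓ)
Saturated M = (A : Pred ∣ M ∣ _) → Smaller A →
              (p : CompleteType M A) → ∃ λ m → Realises m p

-- 2^ A is the power set of A.

2^_ : Set a → Set a
2^ A = A → Bool

infix 4 _∈₂_

_∈₂_ : {A : Set a} → A → 2^ A → Set
x ∈₂ w = T (w x)

-- NIP for the theory of M, with all witnesses taken in M, and with x and y finite tuples of variables.

NIP : {L : Language ℓ} → Structure L → Set ℓ
NIP {L = L} M =
  ¬ (Σ ℕ λ k → Σ ℕ λ n → Σ (Formula L (k ℕ.+ n)) λ φ →
     Σ (ℕ → Vec ∣ M ∣ k) λ as → Σ (2^ ℕ → Vec ∣ M ∣ n) λ bs →
     ∀ i w → (M ⊨ φ [ as i ++ bs w ]) ⇔ (i ∈₂ w))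

FinitelySatisfiableIn : {L : Language ℓ} {M : Structure L} {A : Pred ∣ M ∣ ℓ} →
                        CompleteType M A → ElementarySubstructure M → Set ℓ
FinitelySatisfiableIn p M₀ =
  ∀ φ → φ ∈ formulas p → Σ ∣ structure M₀ ∣ λ m → incl M₀ m ∈ ⟦ φ ⟧

-- { X ∩ M₀ : X ∈ p } as a subset of 2^M₀.

Traces : {L : Language ℓ} {M : Structure L} {A : Pred ∣ M ∣ ℓ} →
         CompleteType M A → (M₀ : ElementarySubstructure M) →
         Pred (2^ ∣ structure M₀ ∣) ℓ
Traces p M₀ χ =
  ∃ λ φ → φ ∈ formulas p × (∀ m → (m ∈₂ χ) ⇔ (incl M₀ m ∈ ⟦ φ ⟧))

-- The product topology on 2^A, with Bool discrete: basic neighbourhoods of f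
-- fix the values of f at finitely many points.

module _ {A : Set ℓ} where

  Open : Pred (2^ A) ℓ → Set ℓ
  Open V = ∀ f → f ∈ V →
           Σ (List A) λ xs → ∀ g → All (λ x → g x ≡ f x) xs → g ∈ V

  Closed : Pred (2^ A) ℓ → Set ℓ
  Closed F = Open (∁ F)

  Fσ : Pred (2^ A) ℓ → Set (suc ℓ)
  Fσ U = Σ (ℕ → Pred (2^ A) ℓ) λ F → (∀ n → Closed (F n)) × U ≐ ⋃ ℕ F

  -- The σ-algebra generated by the open sets, up to extensional equality.
  data Borel : Pred (2^ A) ℓ → Set (suc ℓ) where
    open-set   : ∀ {V} → Open V → Borel V
    complement : ∀ {V} → Borel V → Borel (∁ V)
    union      : ∀ {V : ℕ → Pred (2^ A) ℓ} → (∀ n → Borel (V n)) → Borel (⋃ ℕ V)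
    resp-≐     : ∀ {V W} → V ≐ W → Borel V → Borel W

{-# OPTIONS --safe #-}
module Submission where

-- If M is countable, there are only countably many traces.  Otherwise M realises every
-- finitely satisfiable countable set of formulas in finitely many variables.  Choose a Morley
-- sequence e₀, e₁, … of p over M₀.  For a formula φ(x, y), NIP bounds the length of the
-- alternations of φ(–, b) along realisations of tp(e₀, …, eₙ₋₁ / M₀) that begin with "true",
-- and an alternation that stops can only stop because φ(x, b) or its negation in p forbids
-- the next value.  So φ(x, b) ∈ p iff, for some odd n, b admits an alternation of length n
-- but none of length n + 1.  The second condition is witnessed by a single formula F over M₀
-- true of e₀, …, eₙ; once φ, n and F are fixed, the set of traces of such φ(x, b) is a
-- projection of a type-definable set, hence closed, and there are countably many (φ, n, F).

open import Defs
open import Level using (Level; Lift; _⊔_)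
open import Axiom.DoubleNegationElimination using (em⇒dne)
open import Axiom.ExcludedMiddle using (ExcludedMiddle)
open import Data.Bool.Base using (Bool; true; false; not; T; if_then_else_)
open import Data.Fin.Base as Fin using (Fin; zero; suc; toℕ; lift; _↑ˡ_; _↑ʳ_)
open import Data.Fin.Properties using (toℕ-injective)
open import Data.List.Base as List using (List; []; _∷_)
open import Data.List.Relation.Unary.All as All using (All; []; _∷_)
import Data.List.Relation.Unary.All.Properties as All
open import Data.Maybe.Base using (Maybe; just; nothing; maybe)
open import Data.Nat.Base as ℕ using (ℕ; zero; suc; _+_; _*_; _≤_; _<_; z≤n; s≤s)
open import Data.Nat.Properties
open import Data.Product.Base using (Σ; ∃; _×_; _,_; proj₁; proj₂)
open import Data.Product.Function.NonDependent.Propositional using (_×-⇔_)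
open import Data.Sum.Base using (_⊎_; inj₁; inj₂; [_,_]′)
open import Data.Unit.Base using (⊤)
open import Data.Unit.Polymorphic.Base using (tt)
open import Data.Vec.Base as Vec using (Vec; []; _∷_; _++_; lookup; tabulate)
open import Data.Vec.Properties using (map-id; map-∘; lookup-map; lookup-splitAt; lookup-++ˡ;
  lookup-++ʳ; lookup∘tabulate)
import Data.Vec.Relation.Unary.All as VecAll
import Data.Vec.Relation.Unary.All.Properties as VecAll
open import Function.Base using (_∘_; id)
open import Function.Bundles using (_⇔_; mk⇔; mk↣; module Equivalence; module Injection)
open import Function.Construct.Composition using (_⇔-∘_)
open import Function.Construct.Symmetry using (⇔-sym)
open import Relation.Binary.Definitions using (tri<; tri≈; tri>)
open import Relation.Binary.PropositionalEquality using (_≡_; refl; sym; trans; cong; cong₂; subst)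
open import Relation.Nullary using (¬_; yes; no; contradiction)
open import Relation.Unary using (Pred; _∈_; _⊆_; ∁; _∩_)
open import Relation.Unary.Polymorphic using (U)

open Equivalence using (to; from)

private
  variable
    a b ℓ x : Level
    k l m n : ℕ
    A B X Y : Set a

-- Countable types

abstract

  pair : ℕ → ℕ → ℕ
  pair x y = (x + y) * (x + y) + x

  private
    -- As x is at most s = x + y, the code of (x, y) lies between s² and s² + s < (s + 1)².
    -- Different sums thus give disjoint intervals, and the code determines first s, then x.
    pair-mono : ∀ {x y x′ y′} → x + y < x′ + y′ → pair x y < pair x′ y′
    pair-mono {x} {y} {x′} {y′} s<t = begin-strict
      s * s + x        ≤⟨ +-monoʳ-≤ (s * s) (m≤m+n x y) ⟩
      s * s + s        ≡⟨ trans (+-comm (s * s) s) (sym (*-suc s s)) ⟩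
      s * suc s        <⟨ m<n+m (s * suc s) (s≤s z≤n) ⟩
      suc s * suc s    ≤⟨ *-mono-≤ s<t s<t ⟩
      t * t            ≤⟨ m≤m+n (t * t) x′ ⟩
      t * t + x′       ∎
      where
      open ≤-Reasoning
      s t : ℕ
      s = x + y
      t = x′ + y′

  pair-injective : ∀ {x y x′ y′} → pair x y ≡ pair x′ y′ → x ≡ x′ × y ≡ y′
  pair-injective {x} {y} {x′} {y′} eq with <-cmp (x + y) (x′ + y′)
  ... | tri< s<t _ _ = contradiction eq (<⇒≢ (pair-mono {x} {y} {x′} {y′} s<t))
  ... | tri> _ _ t<s = contradiction (sym eq) (<⇒≢ (pair-mono {x′} {y′} {x} {y} t<s))
  ... | tri≈ _ s≡t _ = x≡x′ , +-cancelˡ-≡ x y y′ (trans s≡t (cong (_+ y′) (sym x≡x′)))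
    where
    x≡x′ : x ≡ x′
    x≡x′ = +-cancelˡ-≡ ((x + y) * (x + y)) x x′ (trans eq (cong (λ z → z * z + x′) (sym s≡t)))

module _ (cA : Countable A) where
  code : A → ℕ
  code = Injection.to cA

  code-injective : ∀ {x y} → code x ≡ code y → x ≡ y
  code-injective = Injection.injective cA

countable-via : {f : A → B} → (∀ {x y} → f x ≡ f y → x ≡ y) → Countable B → Countable A
countable-via {f = f} inj cB = mk↣ {to = λ x → code cB (f x)} λ eq → inj (code-injective cB eq)

countable-ℕ : Countable ℕ
countable-ℕ = mk↣ {to = λ n → n} λ eq → eq

countable-Fin : Countable (Fin n)
countable-Fin = mk↣ toℕ-injective

countable-Σ : {B : A → Set b} → Countable A → (∀ x → Countable (B x)) → Countable (Σ A B)
countable-Σ {A = A} {B = B} cA cB = mk↣ {to = f} inj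
  where
  f : Σ A B → ℕ
  f (x , y) = pair (code cA x) (code (cB x) y)
  inj : ∀ {u v} → f u ≡ f v → u ≡ v
  inj {x , y} {x′ , y′} eq with pair-injective eq
  ... | eq₁ , eq₂ with code-injective cA eq₁
  ... | refl = cong (x ,_) (code-injective (cB x) eq₂)

countable-× : Countable A → Countable B → Countable (A × B)
countable-× cA cB = countable-Σ cA (λ _ → cB)

countable-⊎ : Countable A → Countable B → Countable (A ⊎ B)
countable-⊎ {A = A} {B = B} cA cB = mk↣ {to = f} inj
  where
  f : A ⊎ B → ℕ
  f (inj₁ x) = pair 0 (code cA x)
  f (inj₂ y) = pair 1 (code cB y)
  inj : ∀ {u v} → f u ≡ f v → u ≡ v
  inj {inj₁ x} {inj₁ x′} eq = cong inj₁ (code-injective cA (proj₂ (pair-injective eq)))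
  inj {inj₁ x} {inj₂ y}  eq with () ← proj₁ (pair-injective eq)
  inj {inj₂ y} {inj₁ x}  eq with () ← proj₁ (pair-injective eq)
  inj {inj₂ y} {inj₂ y′} eq = cong inj₂ (code-injective cB (proj₂ (pair-injective eq)))

countable-Maybe : Countable A → Countable (Maybe A)
countable-Maybe {A = A} cA = mk↣ {to = f} inj
  where
  f : Maybe A → ℕ
  f nothing  = 0
  f (just x) = suc (code cA x)
  inj : ∀ {u v} → f u ≡ f v → u ≡ v
  inj {nothing} {nothing} eq = refl
  inj {just x}  {just y}  eq = cong just (code-injective cA (suc-injective eq))

countable-Vec : Countable A → Countable (Vec A n)
countable-Vec {A = A} cA = mk↣ (λ {xs} {ys} → inj xs ys)
  where
  f : Vec A n → ℕ
  f []       = 0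
  f (x ∷ xs) = pair (code cA x) (f xs)
  inj : (xs ys : Vec A n) → f xs ≡ f ys → xs ≡ ys
  inj []       []       eq = refl
  inj (x ∷ xs) (y ∷ ys) eq with pair-injective eq
  ... | eq₁ , eq₂ = cong₂ _∷_ (code-injective cA eq₁) (inj xs ys eq₂)

-- Coding of terms and formulas by numbers

module _ {L : Language ℓ} (cL : CountableLanguage L) where

  private
    -- The constructor is coded apart from its arguments, so that equality of tags disposes of all
    -- pairs of distinct constructors in the injectivity proof.
    tagᵀ bodyᵀ codeᵀ : Term L n → ℕ
    codesᵀ : Vec (Term L n) k → ℕ

    tagᵀ (var _)   = 0
    tagᵀ (app _ _) = 1

    bodyᵀ (var i)    = toℕ i
    -- The symbol is coded together with its arity, so equal codes identify the lengths of the
    -- argument vectors before these are compared.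
    bodyᵀ (app f ts) = pair (code (proj₁ cL) (_ , f)) (codesᵀ ts)

    codeᵀ t = pair (tagᵀ t) (bodyᵀ t)

    codesᵀ []       = 0
    codesᵀ (t ∷ ts) = pair (codeᵀ t) (codesᵀ ts)

    bodyᵀ-injective : (s t : Term L n) → tagᵀ s ≡ tagᵀ t → bodyᵀ s ≡ bodyᵀ t → s ≡ t
    codeᵀ-injective : (s t : Term L n) → codeᵀ s ≡ codeᵀ t → s ≡ t
    codesᵀ-injective : (ss ts : Vec (Term L n) k) → codesᵀ ss ≡ codesᵀ ts → ss ≡ ts

    bodyᵀ-injective (var i)    (var j)    refl eq = cong var (toℕ-injective eq)
    bodyᵀ-injective (app f ss) (app g ts) refl eq with pair-injective eq
    ... | eq₁ , eq₂ with code-injective (proj₁ cL) eq₁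
    ... | refl = cong (app f) (codesᵀ-injective ss ts eq₂)

    codeᵀ-injective s t eq with pair-injective eq
    ... | eq₁ , eq₂ = bodyᵀ-injective s t eq₁ eq₂

    codesᵀ-injective []       []       eq = refl
    codesᵀ-injective (s ∷ ss) (t ∷ ts) eq with pair-injective eq
    ... | eq₁ , eq₂ = cong₂ _∷_ (codeᵀ-injective s t eq₁) (codesᵀ-injective ss ts eq₂)

    tagᶠ bodyᶠ codeᶠ : Formula L n → ℕ

    tagᶠ (_ ≈̇ _)   = 0
    tagᶠ (rel _ _) = 1
    tagᶠ (¬̇ _)     = 2
    tagᶠ (_ ∧̇ _)   = 3
    tagᶠ (∃̇ _)     = 4

    bodyᶠ (s ≈̇ t)    = pair (codeᵀ s) (codeᵀ t)
    bodyᶠ (rel R ts) = pair (code (proj₂ cL) (_ , R)) (codesᵀ ts)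
    bodyᶠ (¬̇ φ)      = codeᶠ φ
    bodyᶠ (φ ∧̇ ψ)    = pair (codeᶠ φ) (codeᶠ ψ)
    bodyᶠ (∃̇ φ)      = codeᶠ φ

    codeᶠ φ = pair (tagᶠ φ) (bodyᶠ φ)

    bodyᶠ-injective : (φ ψ : Formula L n) → tagᶠ φ ≡ tagᶠ ψ → bodyᶠ φ ≡ bodyᶠ ψ → φ ≡ ψ
    codeᶠ-injective : (φ ψ : Formula L n) → codeᶠ φ ≡ codeᶠ ψ → φ ≡ ψ

    bodyᶠ-injective (s ≈̇ t) (s′ ≈̇ t′) refl eq with pair-injective eq
    ... | eq₁ , eq₂ = cong₂ _≈̇_ (codeᵀ-injective s s′ eq₁) (codeᵀ-injective t t′ eq₂)
    bodyᶠ-injective (rel R ss) (rel S ts) refl eq with pair-injective eq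
    ... | eq₁ , eq₂ with code-injective (proj₂ cL) eq₁
    ... | refl = cong (rel R) (codesᵀ-injective ss ts eq₂)
    bodyᶠ-injective (¬̇ φ) (¬̇ ψ) refl eq = cong ¬̇_ (codeᶠ-injective φ ψ eq)
    bodyᶠ-injective (φ ∧̇ φ′) (ψ ∧̇ ψ′) refl eq with pair-injective eq
    ... | eq₁ , eq₂ = cong₂ _∧̇_ (codeᶠ-injective φ ψ eq₁) (codeᶠ-injective φ′ ψ′ eq₂)
    bodyᶠ-injective (∃̇ φ) (∃̇ ψ) refl eq = cong ∃̇_ (codeᶠ-injective φ ψ eq)

    codeᶠ-injective φ ψ eq with pair-injective eq
    ... | eq₁ , eq₂ = bodyᶠ-injective φ ψ eq₁ eq₂

  countable-Formula : Countable (Formula L n)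
  countable-Formula = mk↣ (λ {φ} {ψ} → codeᶠ-injective φ ψ)

-- Renaming, and formulas with parameters

lookup-lift : (v : Vec A n) {ρ : Vec A l} {σ : Vec A k} {r : Fin k → Fin l} →
              (∀ i → lookup ρ (r i) ≡ lookup σ i) →
              ∀ i → lookup (v ++ ρ) (lift n r i) ≡ lookup (v ++ σ) i
lookup-lift []      h i       = h i
lookup-lift (_ ∷ v) h zero    = refl
lookup-lift (_ ∷ v) h (suc i) = lookup-lift v h i

module _ {L : Language ℓ} where

  renameᵀ : (Fin n → Fin m) → Term L n → Term L m
  renameᵀˢ : (Fin n → Fin m) → Vec (Term L n) k → Vec (Term L m) k

  renameᵀ r (var i)    = var (r i)
  renameᵀ r (app f ts) = app f (renameᵀˢ r ts)

  renameᵀˢ r []       = []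
  renameᵀˢ r (t ∷ ts) = renameᵀ r t ∷ renameᵀˢ r ts

  rename : (Fin n → Fin m) → Formula L n → Formula L m
  rename r (s ≈̇ t)    = renameᵀ r s ≈̇ renameᵀ r t
  rename r (rel R ts) = rel R (renameᵀˢ r ts)
  rename r (¬̇ φ)      = ¬̇ rename r φ
  rename r (φ ∧̇ ψ)    = rename r φ ∧̇ rename r ψ
  rename r (∃̇ φ)      = ∃̇ rename (lift 1 r) φ

  ⊤̇ : Formula L n
  ⊤̇ = ∃̇ (var zero ≈̇ var zero)

  ∃̇^ : ∀ n → Formula L (n + k) → Formula L k
  ∃̇^ zero    φ = φ
  ∃̇^ (suc n) φ = ∃̇^ n (∃̇ φ)

  literal : Bool → Formula L n → Formula L n
  literal true  φ = φ
  literal false φ = ¬̇ φ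

  -- Moving the first variable behind the next n turns it into the first parameter. This serves both
  -- to substitute a constant for it and to quantify the other variables away.
  rotate : ∀ n → Formula L (suc (n + k)) → Formula L (n + suc k)
  rotate {k} n = rename r
    where
    r : Fin (suc (n + k)) → Fin (n + suc k)
    r zero    = n ↑ʳ zero
    r (suc i) = lift n suc i

  module _ (M : Structure L) where

    module _ {r : Fin n → Fin m} {ρ : Vec ∣ M ∣ m} {σ : Vec ∣ M ∣ n}
             (h : ∀ i → lookup ρ (r i) ≡ lookup σ i) where

      eval-rename : ∀ t → eval M ρ (renameᵀ r t) ≡ eval M σ t
      evals-rename : (ts : Vec (Term L n) k) → evals M ρ (renameᵀˢ r ts) ≡ evals M σ ts

      eval-rename (var i)    = h i
      eval-rename (app f ts) = cong (Structure.funᴵ M f) (evals-rename ts)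

      evals-rename []       = refl
      evals-rename (t ∷ ts) = cong₂ _∷_ (eval-rename t) (evals-rename ts)

    ⊨-rename : {r : Fin n → Fin m} {ρ : Vec ∣ M ∣ m} {σ : Vec ∣ M ∣ n} →
               (∀ i → lookup ρ (r i) ≡ lookup σ i) →
               ∀ φ → (M ⊨ rename r φ [ ρ ]) ⇔ (M ⊨ φ [ σ ])
    ⊨-rename h (s ≈̇ t) = mk⇔
      (λ e → trans (sym (eval-rename h s)) (trans e (eval-rename h t)))
      (λ e → trans (eval-rename h s) (trans e (sym (eval-rename h t))))
    ⊨-rename h (rel R ts) = mk⇔
      (subst (Structure.relᴵ M R) (evals-rename h ts))
      (subst (Structure.relᴵ M R) (sym (evals-rename h ts)))
    ⊨-rename h (¬̇ φ) = mk⇔ (_∘ from (⊨-rename h φ)) (_∘ to (⊨-rename h φ))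
    ⊨-rename h (φ ∧̇ ψ) = ⊨-rename h φ ×-⇔ ⊨-rename h ψ
    ⊨-rename h (∃̇ φ) = mk⇔
      (λ (c , p) → c , to (⊨-rename (lookup-lift (c ∷ []) h) φ) p)
      (λ (c , p) → c , from (⊨-rename (lookup-lift (c ∷ []) h) φ) p)

    ⊨-⊤̇ : (ρ : Vec ∣ M ∣ n) → M ⊨ ⊤̇ [ ρ ]
    ⊨-⊤̇ ρ = Structure.nonempty M , refl

    -- The right-hand side is the form in which `NIP` and `Traces` record truth values.
    ⊨-literal : ∀ w (φ : Formula L n) {ρ : Vec ∣ M ∣ n} →
                (M ⊨ literal w φ [ ρ ]) ⇔ (T w ⇔ (M ⊨ φ [ ρ ]))
    ⊨-literal true  φ = mk⇔ (λ p → mk⇔ (λ _ → p) _) λ h → to h _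
    ⊨-literal false φ = mk⇔ (λ p → mk⇔ (λ ()) p) from

    ⊨-∃̇^ : ∀ n (φ : Formula L (n + k)) {ρ : Vec ∣ M ∣ k} →
            (M ⊨ ∃̇^ n φ [ ρ ]) ⇔ ∃ λ v → M ⊨ φ [ v ++ ρ ]
    ⊨-∃̇^ zero    φ = mk⇔ ([] ,_) λ { ([] , p) → p }
    ⊨-∃̇^ (suc n) φ = mk⇔
      (λ p → let v , c , q = to (⊨-∃̇^ n (∃̇ φ)) p in c ∷ v , q)
      λ { (c ∷ v , q) → from (⊨-∃̇^ n (∃̇ φ)) (v , c , q) }

    ⊨-rotate : (v : Vec ∣ M ∣ n) {c : ∣ M ∣} {ρ : Vec ∣ M ∣ k} (φ : Formula L (suc (n + k))) →
               (M ⊨ rotate n φ [ v ++ c ∷ ρ ]) ⇔ (M ⊨ φ [ c ∷ v ++ ρ ])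
    ⊨-rotate v {c} {ρ} = ⊨-rename λ where
      zero    → lookup-++ʳ v (c ∷ ρ) zero
      (suc i) → lookup-lift v (λ _ → refl) i

-- Constants are names, interpreted only in `Sat`. Formulas over countably many names are therefore
-- countable, and new names can be added without touching the model.
record ParamFormula (L : Language ℓ) (X : Set x) (n : ℕ) : Set (ℓ ⊔ x) where
  constructor _⟨_⟩
  field
    {size}    : ℕ
    body      : Formula L (n + size)
    constants : Vec X size

open ParamFormula public

countable-ParamFormula : {L : Language ℓ} → CountableLanguage L → Countable X →
                         Countable (ParamFormula L X n)
countable-ParamFormula cL cX = countable-via
  {f = λ F → size F , body F , constants F} (λ { refl → refl })
  (countable-Σ countable-ℕ λ _ → countable-× (countable-Formula cL) (countable-Vec cX))

module _ {L : Language ℓ} where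

  infixr 6 _∧ₚ_
  infix 7 ¬ₚ_

  ⊤ₚ : ParamFormula L X n
  ⊤ₚ = ⊤̇ ⟨ [] ⟩

  ¬ₚ_ : ParamFormula L X n → ParamFormula L X n
  ¬ₚ (φ ⟨ b ⟩) = (¬̇ φ) ⟨ b ⟩

  _∧ₚ_ : ParamFormula L X n → ParamFormula L X n → ParamFormula L X n
  _∧ₚ_ {n = n} (_⟨_⟩ {k} φ b) (_⟨_⟩ {l} ψ c) =
    (rename (lift n (_↑ˡ l)) φ ∧̇ rename (lift n (k ↑ʳ_)) ψ) ⟨ b ++ c ⟩

  literalₚ : Bool → ParamFormula L X n → ParamFormula L X n
  literalₚ w (φ ⟨ b ⟩) = literal w φ ⟨ b ⟩

  mapₚ : (X → Y) → ParamFormula L X n → ParamFormula L Y n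
  mapₚ g (φ ⟨ b ⟩) = φ ⟨ Vec.map g b ⟩

  specialise : X → ParamFormula L X (suc n) → ParamFormula L X n
  specialise {n = n} c (φ ⟨ b ⟩) = rotate n φ ⟨ c ∷ b ⟩

  renameₚ : (Fin n → Fin m) → ParamFormula L X n → ParamFormula L X m
  renameₚ {n = n} {m = m} r (_⟨_⟩ {k} φ b) =
    rename (λ i → [ (_↑ˡ k) ∘ r , (m ↑ʳ_) ]′ (Fin.splitAt n i)) φ ⟨ b ⟩

  ⋀ : List (ParamFormula L X n) → ParamFormula L X n
  ⋀ = List.foldr _∧ₚ_ ⊤ₚ

  module _ (M : Structure L) (f : X → ∣ M ∣) where

    Sat : Vec ∣ M ∣ n → ParamFormula L X n → Set ℓ
    Sat v (φ ⟨ b ⟩) = M ⊨ φ [ v ++ Vec.map f b ]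

    toₓ : ParamFormula L X 1 → Formulaₓ M
    toₓ (φ ⟨ b ⟩) = φ ⟨x, Vec.map f b ⟩

    private
      lookup-map-++ˡ : (b : Vec X k) (c : Vec X l) →
                       ∀ i → lookup (Vec.map f (b ++ c)) (i ↑ˡ l) ≡ lookup (Vec.map f b) i
      lookup-map-++ˡ {l = l} b c i = trans (lookup-map (i ↑ˡ l) f (b ++ c))
        (trans (cong f (lookup-++ˡ b c i)) (sym (lookup-map i f b)))

      lookup-map-++ʳ : (b : Vec X k) (c : Vec X l) →
                       ∀ i → lookup (Vec.map f (b ++ c)) (k ↑ʳ i) ≡ lookup (Vec.map f c) i
      lookup-map-++ʳ {k = k} b c i = trans (lookup-map (k ↑ʳ i) f (b ++ c))
        (trans (cong f (lookup-++ʳ b c i)) (sym (lookup-map i f c)))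

    Sat-specialise : (v : Vec ∣ M ∣ n) (c : X) (F : ParamFormula L X (suc n)) →
                     Sat v (specialise c F) ⇔ Sat (f c ∷ v) F
    Sat-specialise v c (φ ⟨ b ⟩) = ⊨-rotate M v φ

    Sat-∧ : (v : Vec ∣ M ∣ n) (F G : ParamFormula L X n) →
            Sat v (F ∧ₚ G) ⇔ (Sat v F × Sat v G)
    Sat-∧ v (φ ⟨ b ⟩) (ψ ⟨ c ⟩) =
      ⊨-rename M (lookup-lift v (lookup-map-++ˡ b c)) φ ×-⇔
      ⊨-rename M (lookup-lift v (lookup-map-++ʳ b c)) ψ

    Sat-⋀ : (v : Vec ∣ M ∣ n) (Fs : List (ParamFormula L X n)) →
            Sat v (⋀ Fs) ⇔ All (Sat v) Fs
    Sat-⋀ v []       = mk⇔ (λ _ → []) (λ _ → ⊨-⊤̇ M (v ++ []))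
    Sat-⋀ v (F ∷ Fs) = mk⇔
      (λ p → let q , qs = to (Sat-∧ v F (⋀ Fs)) p in q ∷ to (Sat-⋀ v Fs) qs)
      λ { (q ∷ qs) → from (Sat-∧ v F (⋀ Fs)) (q , from (Sat-⋀ v Fs) qs) }

    Sat-rename : {r : Fin n → Fin m} {v : Vec ∣ M ∣ n} {w : Vec ∣ M ∣ m} →
                 (∀ i → lookup w (r i) ≡ lookup v i) →
                 ∀ F → Sat w (renameₚ r F) ⇔ Sat v F
    Sat-rename {n = n} {r = r} {v} {w} h (φ ⟨ b ⟩) = ⊨-rename M h′ φ
      where
      h′ : ∀ i → lookup (w ++ Vec.map f b) ([ (_↑ˡ _) ∘ r , (_ ↑ʳ_) ]′ (Fin.splitAt n i)) ≡
                 lookup (v ++ Vec.map f b) i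
      h′ i with Fin.splitAt n i | lookup-splitAt n v (Vec.map f b) i
      ... | inj₁ j | eq = trans (lookup-++ˡ w _ (r j)) (trans (h j) (sym eq))
      ... | inj₂ j | eq = trans (lookup-++ʳ w _ j) (sym eq)

  Sat-mapₚ : (M : Structure L) (f : Y → ∣ M ∣) (g : X → Y) (v : Vec ∣ M ∣ n) →
             ∀ F → Sat M f v (mapₚ g F) ≡ Sat M (f ∘ g) v F
  Sat-mapₚ M f g v (φ ⟨ b ⟩) = cong (λ c → M ⊨ φ [ v ++ c ]) (sym (map-∘ f g b))

-- Pattern φ w a b says that φ(aᵢ, b) holds exactly for those i with w i, where a lists
-- a₀, a₁, … from right to left.

module _ {L : Language ℓ} (φ : Formula L (suc k)) (w : ℕ → Bool) where

  -- `f` and `g` locate the sequence and the parameters in the ambient context, because patterns are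
  -- used in contexts of different layouts.
  patternᶠ : ∀ n → (Fin n → Fin m) → (Fin k → Fin m) → Formula L m
  patternᶠ zero    f g = ⊤̇
  patternᶠ (suc n) f g =
    rename (λ { zero → f zero ; (suc j) → g j }) (literal (w n) φ) ∧̇ patternᶠ n (f ∘ suc) g

  module _ (M : Structure L) where

    Pattern : Vec ∣ M ∣ n → Vec ∣ M ∣ k → Set ℓ
    Pattern []              b = Lift ℓ ⊤
    Pattern (_∷_ {n} c a) b = (M ⊨ literal (w n) φ [ c ∷ b ]) × Pattern a b

    ⊨-patternᶠ : {f : Fin n → Fin m} {g : Fin k → Fin m} {ρ : Vec ∣ M ∣ m}
                 (a : Vec ∣ M ∣ n) (b : Vec ∣ M ∣ k) →
                 (∀ i → lookup ρ (f i) ≡ lookup a i) → (∀ j → lookup ρ (g j) ≡ lookup b j) →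
                 (M ⊨ patternᶠ n f g [ ρ ]) ⇔ Pattern a b
    ⊨-patternᶠ {ρ = ρ} [] b hf hg = mk⇔ _ λ _ → ⊨-⊤̇ M ρ
    ⊨-patternᶠ (c ∷ a) b hf hg =
      ⊨-rename M (λ { zero → hf zero ; (suc j) → hg j }) (literal (w _) φ) ×-⇔
      ⊨-patternᶠ a b (hf ∘ suc) hg

-- Countable saturation

Infinite : Pred ℕ ℓ → Set ℓ
Infinite S = ∀ n → ∃ λ i → n ≤ i × i ∈ S

Range : (ℕ → A) → Pred A _
Range s x = ∃ λ n → s n ≡ x

Range-Vec : {s : ℕ → A} {b : Vec A n} → VecAll.All (_∈ Range s) b → ∃ λ c → Vec.map s c ≡ b
Range-Vec VecAll.[] = [] , refl
Range-Vec ((n , eq) VecAll.∷ h) = let c , eqs = Range-Vec h in n ∷ c , cong₂ _∷_ eq eqs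

module _ (em : ∀ a → ExcludedMiddle a) where

  by-contradiction : {A : Set a} → ¬ ¬ A → A
  by-contradiction {a} = em⇒dne (em a)

  enumerate : Countable A → A → Σ (ℕ → A) λ e → ∀ x → x ∈ Range e
  enumerate {a} {A} cA x₀ = e , λ x → code cA x , e-code x
    where
    e : ℕ → A
    e n with em a {∃ λ x → code cA x ≡ n}
    ... | yes (x , _) = x
    ... | no _        = x₀
    e-code : ∀ x → e (code cA x) ≡ x
    e-code x with em a {∃ λ y → code cA y ≡ code cA x}
    ... | yes (_ , eq) = code-injective cA eq
    ... | no ∄         = contradiction (x , refl) ∄

  -- A countable substitute for a nonprincipal ultrafilter: decreasing infinite sets of indices,
  -- each settling one more of the predicates.
  module Thinning {ℓ} (P : ℕ → Pred ℕ ℓ) where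

    infinite-∁ : {S Q : Pred ℕ ℓ} → Infinite S → ¬ Infinite (S ∩ Q) → Infinite (S ∩ ∁ Q)
    infinite-∁ {S} {Q} infS finSQ n = by-contradiction λ ∄ →
      finSQ λ m → let i , m⊔n≤i , i∈S = infS (m ℕ.⊔ n) in
        i , ≤-trans (m≤m⊔n m n) m⊔n≤i , i∈S ,
        by-contradiction λ i∉Q → ∄ (i , ≤-trans (m≤n⊔m m n) m⊔n≤i , i∈S , i∉Q)

    refine : (S : Pred ℕ ℓ) (Q : Pred ℕ ℓ) → Infinite S →
             Σ (Pred ℕ ℓ) λ S′ → Infinite S′ × S′ ⊆ S × (S′ ⊆ Q ⊎ S′ ⊆ ∁ Q)
    refine S Q infS with em ℓ {Infinite (S ∩ Q)}
    ... | yes inf = S ∩ Q , inf , proj₁ , inj₁ proj₂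
    ... | no fin  = S ∩ ∁ Q , infinite-∁ infS fin , proj₁ , inj₂ proj₂

    stage : ℕ → Σ (Pred ℕ ℓ) Infinite
    stage zero    = (λ _ → Lift ℓ ⊤) , λ n → n , ≤-refl , _
    stage (suc n) = let S , infS = stage n ; S′ , infS′ , _ = refine S (P n) infS in S′ , infS′

    thinned : ℕ → Pred ℕ ℓ
    thinned n = proj₁ (stage n)

    thinned-infinite : ∀ n → Infinite (thinned n)
    thinned-infinite n = proj₂ (stage n)

    thinned-antitone : ∀ {m n} → m ≤ n → thinned n ⊆ thinned m
    thinned-antitone {n = zero} z≤n = id
    thinned-antitone {n = suc n} m≤ with m≤n⇒m<n∨m≡n m≤
    ... | inj₂ refl = id
    ... | inj₁ (s≤s m≤n) = thinned-antitone m≤n ∘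
      proj₁ (proj₂ (proj₂ (refine (thinned n) (P n) (thinned-infinite n))))

    thinned-decides : ∀ n → thinned (suc n) ⊆ P n ⊎ thinned (suc n) ⊆ ∁ (P n)
    thinned-decides n = proj₂ (proj₂ (proj₂ (refine (thinned n) (P n) (thinned-infinite n))))

  module _ {L : Language ℓ} (cL : CountableLanguage L) (M : Structure L)
           (saturated : Saturated M) (uncountable : ¬ Countable ∣ M ∣) where

    -- An injection of M into the range of a sequence would, through the indices, embed M in ℕ. So
    -- an uncountable saturated M realises types over countable sets.
    Smaller-Range : (s : ℕ → ∣ M ∣) → Smaller (Range s)
    Smaller-Range s (f , f-injective , h) = uncountable (mk↣ {to = λ x → proj₁ (h x)} λ {x} {y} eq →
      f-injective (trans (sym (proj₂ (h x))) (trans (cong s eq) (proj₂ (h y)))))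

    -- Saturation asks for a complete type, so the given formulas must first be completed. The
    -- points from `finsat` satisfy F j from index j on, hence their limit type contains every F j.
    realise₁ : Countable X → (f : X → ∣ M ∣) (F : ℕ → ParamFormula L X 1) →
               (∀ i → ∃ λ c → ∀ j → j ≤ i → Sat M f (c ∷ []) (F j)) →
               ∃ λ c → ∀ j → Sat M f (c ∷ []) (F j)
    realise₁ {X = X} cX f F finsat = c , λ j → c-realises (toₓ M f (F j))
      (f-params (F j) , j , λ i _ j≤i → proj₂ (finsat i) j j≤i)
      where
      s : ℕ → ∣ M ∣
      -- `Maybe` leaves something to enumerate when X is empty; the point at `nothing` is arbitrary.
      s = maybe f (Structure.nonempty M) ∘ proj₁ (enumerate (countable-Maybe cX) nothing)

      f∈Range : ∀ x → f x ∈ Range s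
      f∈Range x = let n , eq = proj₂ (enumerate (countable-Maybe cX) nothing) (just x)
                  in n , cong (maybe f (Structure.nonempty M)) eq

      f-params : (G : ParamFormula L X 1) → ParamsIn (Range s) (toₓ M f G)
      f-params (_ ⟨ b ⟩) = VecAll.map⁺ (VecAll.universal f∈Range b)

      -- With indices into s as names, the formulas over the range of s can be enumerated.
      g : ℕ → ParamFormula L ℕ 1
      g = proj₁ (enumerate (countable-ParamFormula cL countable-ℕ) ⊤ₚ)

      g-onto : ∀ φ → ParamsIn (Range s) φ → ∃ λ n → toₓ M s (g n) ≡ φ
      g-onto (φ ⟨x, b ⟩) h with Range-Vec h
      ... | c , refl =
        let n , eq = proj₂ (enumerate (countable-ParamFormula cL countable-ℕ) ⊤ₚ) (φ ⟨ c ⟩)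
        in n , cong (toₓ M s) eq

      point : ℕ → ∣ M ∣
      point i = proj₁ (finsat i)

      open Thinning (λ n i → point i ∈ ⟦ toₓ M s (g n) ⟧)

      -- The type of a subsequence of these points along which every formula over the range of s is
      -- eventually constant.
      limit : CompleteType M (Range s)
      limit .CompleteType.formulas φ =
        ParamsIn (Range s) φ × ∃ λ n → ∀ i → i ∈ thinned n → n ≤ i → point i ∈ ⟦ φ ⟧
      limit .CompleteType.over φ = proj₁
      limit .CompleteType.consistent Γ h =
        let n , k = eventually Γ h ; i , n≤i , i∈ = thinned-infinite n n in point i , k i i∈ n≤i
        where
        eventually : ∀ Γ → All (_∈ formulas limit) Γ →
                     ∃ λ n → ∀ i → i ∈ thinned n → n ≤ i → All (λ φ → point i ∈ ⟦ φ ⟧) Γ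
        eventually []      []                  = 0 , λ _ _ _ → []
        eventually (φ ∷ Γ) ((_ , n , h) ∷ hs) =
          let n′ , h′ = eventually Γ hs in
          -- The bound serves both as stage of the thinning and as lower bound for the index, so one
          -- maximum works for all of Γ.
          n ℕ.⊔ n′ , λ i i∈ ≤i →
            h i (thinned-antitone (m≤m⊔n n n′) i∈) (≤-trans (m≤m⊔n n n′) ≤i) ∷
            h′ i (thinned-antitone (m≤n⊔m n n′) i∈) (≤-trans (m≤n⊔m n n′) ≤i)
      limit .CompleteType.complete φ h with g-onto φ h
      ... | n , refl with thinned-decides n
      ... | inj₁ t = inj₁ (h , suc n , λ i i∈ _ → t i∈)
      ... | inj₂ t = inj₂ (h , suc n , λ i i∈ _ → t i∈)

      c : ∣ M ∣
      c = proj₁ (saturated (Range s) (Smaller-Range s) limit)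

      c-realises : Realises c limit
      c-realises = proj₂ (saturated (Range s) (Smaller-Range s) limit)

    -- Induction on the number of variables: choose a first coordinate that extends to a solution of
    -- every initial segment of F, make it a new constant `nothing`, and solve for the rest.
    realiseℕ : Countable X → (f : X → ∣ M ∣) (n : ℕ) (F : ℕ → ParamFormula L X n) →
               (∀ i → ∃ λ v → ∀ j → j ≤ i → Sat M f v (F j)) →
               ∃ λ v → ∀ j → Sat M f v (F j)
    realiseℕ cX f zero F finsat = [] , satisfied
      where
      satisfied : ∀ j → Sat M f [] (F j)
      satisfied j with finsat j
      ... | [] , h = h j ≤-refl
    realiseℕ {X = X} cX f (suc n) F finsat =
      let v , h = realiseℕ (countable-Maybe cX) f′ n F′ finsat′ in
      c ∷ v , λ j → to (Sat-F′ v j) (h j)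
      where
      upTo : ℕ → List (ParamFormula L X (suc n))
      upTo i = List.applyUpTo F (suc i)

      project : ParamFormula L X (suc n) → ParamFormula L X 1
      project (φ ⟨ b ⟩) = ∃̇^ n (rotate n φ) ⟨ b ⟩

      Sat-project : ∀ c G → Sat M f (c ∷ []) (project G) ⇔ ∃ λ v → Sat M f (c ∷ v) G
      Sat-project c (φ ⟨ b ⟩) = mk⇔
        (λ p → let v , q = to (⊨-∃̇^ M n (rotate n φ)) p in v , to (⊨-rotate M v φ) q)
        (λ (v , q) → from (⊨-∃̇^ M n (rotate n φ)) (v , from (⊨-rotate M v φ) q))

      -- Conjunctions are projected, not single formulas: the rest of the tuple must be a common
      -- witness for F 0, ..., F j.
      projections : ∀ i → ∃ λ c → ∀ j → j ≤ i → Sat M f (c ∷ []) (project (⋀ (upTo j)))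
      projections i with finsat i
      ... | c ∷ v , h = c , λ j j≤i → from (Sat-project c (⋀ (upTo j)))
        (v , from (Sat-⋀ M f (c ∷ v) (upTo j))
               (All.applyUpTo⁺₁ F (suc j) λ { (s≤s k≤j) → h _ (≤-trans k≤j j≤i) }))

      c : ∣ M ∣
      c = proj₁ (realise₁ cX f (project ∘ ⋀ ∘ upTo) projections)

      f′ : Maybe X → ∣ M ∣
      f′ = maybe f c

      F′ : ℕ → ParamFormula L (Maybe X) n
      F′ j = specialise nothing (mapₚ just (F j))

      Sat-F′ : ∀ v j → Sat M f′ v (F′ j) ⇔ Sat M f (c ∷ v) (F j)
      Sat-F′ v j = subst (Sat M f′ v (F′ j) ⇔_) (Sat-mapₚ M f′ just (c ∷ v) (F j))
                         (Sat-specialise M f′ v nothing (mapₚ just (F j)))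

      finsat′ : ∀ i → ∃ λ v → ∀ j → j ≤ i → Sat M f′ v (F′ j)
      finsat′ i =
        let v , h = to (Sat-project c (⋀ (upTo i)))
                       (proj₂ (realise₁ cX f (project ∘ ⋀ ∘ upTo) projections) i)
        in v , λ j j≤i → from (Sat-F′ v j)
             (All.applyUpTo⁻ F (suc i) (to (Sat-⋀ M f (c ∷ v) (upTo i)) h) (s≤s j≤i))

    realise : {I : Set a} → Countable I → Countable X → (f : X → ∣ M ∣)
              (F : I → ParamFormula L X n) →
              (∀ is → ∃ λ v → All (λ i → Sat M f v (F i)) is) →
              ∃ λ v → ∀ i → Sat M f v (F i)
    realise {a} {n = n} {I = I} cI cX f F finsat with em a {I}
    ... | no ¬I = proj₁ (finsat []) , λ i → contradiction i ¬I
    ... | yes i₀ = proj₁ realised , λ i → let k , eq = proj₂ (enumerate cI i₀) i in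
                     subst (λ i → Sat M f _ (F i)) eq (proj₂ realised k)
      where
      e : ℕ → I
      e = proj₁ (enumerate cI i₀)
      realised : ∃ λ v → ∀ j → Sat M f v (F (e j))
      realised = realiseℕ cX f n (F ∘ e) λ i →
        let v , h = finsat (List.applyUpTo e (suc i)) in
        v , λ j j≤i → All.applyUpTo⁻ e (suc i) h (s≤s j≤i)

-- Closed and Fσ sets of traces

module _ (em : ∀ a → ExcludedMiddle a) where

  Closed⇒Borel : {A : Set ℓ} {F : Pred (2^ A) ℓ} → Closed F → Borel F
  Closed⇒Borel closed = resp-≐ (by-contradiction em , λ p ¬p → ¬p p) (complement (open-set closed))

  Fσ⇒Borel : {A : Set ℓ} {V : Pred (2^ A) ℓ} → Fσ V → Borel V
  Fσ⇒Borel (F , closed , V⊆ , ⊆V) = resp-≐ (⊆V , V⊆) (union λ n → Closed⇒Borel (closed n))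

  Fσ-⋃ : {A : Set ℓ} {V : Pred (2^ A) ℓ} {J : Set a} → Countable J → J →
         (F : J → Pred (2^ A) ℓ) → (∀ j → Closed (F j)) →
         (∀ χ → (χ ∈ V) ⇔ ∃ λ j → χ ∈ F j) → Fσ V
  Fσ-⋃ cJ j₀ F closed V⇔ with enumerate em cJ j₀
  ... | e , e-onto = F ∘ e , closed ∘ e ,
    (λ {χ} χ∈V → let j , χ∈F = to (V⇔ χ) χ∈V ; n , eq = e-onto j
                 in n , subst (λ j → χ ∈ F j) (sym eq) χ∈F) ,
    λ {χ} (n , χ∈F) → from (V⇔ χ) (e n , χ∈F)

  -- As Q does not depend on χ, the set is F or empty. Such side conditions can thus move from the
  -- index of a union into its members, leaving an index type of pure syntax.
  Closed-× : {A : Set ℓ} {Q : Set ℓ} {F : Pred (2^ A) ℓ} → Closed F → Closed (λ χ → Q × χ ∈ F)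
  Closed-× {ℓ} {Q = Q} closed χ χ∉ with em ℓ {Q}
  ... | no ¬q = [] , λ _ _ (q , _) → ¬q q
  ... | yes q = let xs , h = closed χ (λ χ∈F → χ∉ (q , χ∈F)) in
                xs , λ χ′ agree (_ , χ′∈F) → h χ′ agree χ′∈F

  module _ {L : Language ℓ} (cL : CountableLanguage L) (M : Structure L) where

    Fσ-Traces-countable : Countable ∣ M ∣ → {P : Pred ∣ M ∣ ℓ} (p : CompleteType M P) →
                          (M₀ : ElementarySubstructure M) → Fσ (Traces p M₀)
    Fσ-Traces-countable cM p M₀ = Fσ-⋃
      (countable-via {f = λ φ → _⟨_⟩ {n = 1} (formula φ) (params φ)} (λ { refl → refl })
                     (countable-ParamFormula cL cM))
      -- The set with index φ consists of the trace of φ if φ is in p and is empty otherwise.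
      (⊤̇ ⟨x, [] ⟩) _ (λ φ → Closed-× (Closed-singleton ⟦ φ ⟧)) λ χ → mk⇔ id id
      where
      Closed-singleton : (S : Pred ∣ M ∣ ℓ) → Closed λ χ → ∀ m → (m ∈₂ χ) ⇔ (incl M₀ m ∈ S)
      Closed-singleton S χ χ∉ with em ℓ {∃ λ m → ¬ ((m ∈₂ χ) ⇔ (incl M₀ m ∈ S))}
      ... | no ∄ = contradiction (λ m → by-contradiction em λ h → ∄ (m , h)) χ∉
      ... | yes (m , m≢) = m ∷ [] , λ { χ′ (eq ∷ []) h → m≢ (subst (λ t → T t ⇔ _) eq (h m)) }

    module _ (saturated : Saturated M) (uncountable : ¬ Countable ∣ M ∣)
             (M₀ : ElementarySubstructure M) (cM₀ : Countable ∣ structure M₀ ∣) where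

      -- By compactness, a projection of a type-definable set is closed.
      Closed-traces : {I : Set ℓ} → Countable I → (F : I → ParamFormula L ∣ structure M₀ ∣ n) →
                      (G : ParamFormula L ∣ structure M₀ ∣ (suc n)) →
                      Closed λ χ → ∃ λ v → (∀ i → Sat M (incl M₀) v (F i)) ×
                        (∀ m → (m ∈₂ χ) ⇔ Sat M (incl M₀) (incl M₀ m ∷ v) G)
      -- Finitely many conditions in H mention finitely many points of M₀. If no neighbourhood of χ
      -- avoids the set, some member χ′ agrees with χ at these points, and its tuple satisfies the
      -- conditions.
      Closed-traces {n = n} {I = I} cI F G χ χ∉ = by-contradiction em λ no-nbhd →
        let v , h = realise em cL M saturated uncountable (countable-⊎ cI cM₀) cM₀ (incl M₀) H
              λ is → by-contradiction em λ unsat → no-nbhd (points is , λ χ′ agree (v , hF , hG) →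
                unsat (v , satisfied hF hG is agree))
        in χ∉ (v , (λ i → h (inj₁ i)) , λ m → to (Sat-H₂ v m) (h (inj₂ m)))
        where
        H : I ⊎ ∣ structure M₀ ∣ → ParamFormula L ∣ structure M₀ ∣ n
        H (inj₁ i) = F i
        H (inj₂ m) = literalₚ (χ m) (specialise m G)

        Sat-literal : ∀ w (v : Vec ∣ M ∣ n) E →
                      Sat M (incl M₀) v (literalₚ w E) ⇔ (T w ⇔ Sat M (incl M₀) v E)
        Sat-literal w v (φ ⟨ b ⟩) = ⊨-literal M w φ

        Sat-H₂ : ∀ v m → Sat M (incl M₀) v (H (inj₂ m)) ⇔
                         ((m ∈₂ χ) ⇔ Sat M (incl M₀) (incl M₀ m ∷ v) G)
        Sat-H₂ v m = mk⇔
          (λ p → Sat-specialise M (incl M₀) v m G ⇔-∘ to (Sat-literal (χ m) v (specialise m G)) p)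
          (λ p → from (Sat-literal (χ m) v (specialise m G))
                   (⇔-sym (Sat-specialise M (incl M₀) v m G) ⇔-∘ p))

        points : List (I ⊎ ∣ structure M₀ ∣) → List ∣ structure M₀ ∣
        points []            = []
        points (inj₁ _ ∷ is) = points is
        points (inj₂ m ∷ is) = m ∷ points is

        satisfied : ∀ {χ′ v} → (∀ i → Sat M (incl M₀) v (F i)) →
                    (∀ m → (m ∈₂ χ′) ⇔ Sat M (incl M₀) (incl M₀ m ∷ v) G) →
                    ∀ is → All (λ m → χ′ m ≡ χ m) (points is) →
                    All (λ i → Sat M (incl M₀) v (H i)) is
        satisfied hF hG []            []           = []
        satisfied hF hG (inj₁ i ∷ is) agree        = hF i ∷ satisfied hF hG is agree
        satisfied {v = v} hF hG (inj₂ m ∷ is) (eq ∷ agree) =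
          from (Sat-H₂ v m) (subst (λ b → T b ⇔ _) eq (hG m)) ∷ satisfied hF hG is agree

-- Morley sequences and alternation

alternating : ℕ → Bool
alternating zero    = true
alternating (suc n) = not (alternating n)

alternating-even : ∀ n → alternating (n * 2) ≡ true
alternating-even zero    = refl
alternating-even (suc n) = cong (not ∘ not) (alternating-even n)

-- Vectors list the latest term first, so c₀ has the even index 2n, where an alternation is true,
-- and c₁ has index 2n + 1, where it is false.
pick : (ℕ → Bool) → ∀ n → Vec A (n * 2) → Vec A n
pick w zero    []            = []
pick w (suc n) (c₁ ∷ c₀ ∷ a) = (if w n then c₀ else c₁) ∷ pick w n a

pick-⊆ : ∀ w n (a : Vec A (n * 2)) i → ∃ λ j → lookup a j ≡ lookup (pick w n a) i
pick-⊆ w (suc n) (c₁ ∷ c₀ ∷ a) zero with w n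
... | true  = suc zero , refl
... | false = zero , refl
pick-⊆ w (suc n) (c₁ ∷ c₀ ∷ a) (suc i) = let j , eq = pick-⊆ w n a i in suc (suc j) , eq

module _ {L : Language ℓ} (M : Structure L) where

  Pattern-pick : (φ : Formula L (suc k)) (w : ℕ → Bool) → ∀ n (a : Vec ∣ M ∣ (n * 2)) {b} →
                 Pattern φ alternating M a b → Pattern φ w M (pick w n a) b
  Pattern-pick φ w zero    []            _              = _
  Pattern-pick φ w (suc n) (c₁ ∷ c₀ ∷ a) {b} (p₁ , p₀ , ps) =
    head (w n) , Pattern-pick φ w n a ps
    where
    head : ∀ t → M ⊨ literal t φ [ (if t then c₀ else c₁) ∷ b ]
    head true  = subst (λ t → M ⊨ literal t φ [ c₀ ∷ b ]) (alternating-even n) p₀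
    head false = subst (λ t → M ⊨ literal t φ [ c₁ ∷ b ]) (cong not (alternating-even n)) p₁

  _∧ₓ_ : Formulaₓ M → Formulaₓ M → Formulaₓ M
  (φ ⟨x, b ⟩) ∧ₓ (ψ ⟨x, c ⟩) = body F ⟨x, constants F ⟩
    where F = _⟨_⟩ {n = 1} φ b ∧ₚ ψ ⟨ c ⟩

  ∈-∧ₓ : ∀ φ ψ {m} → (m ∈ ⟦ φ ∧ₓ ψ ⟧) ⇔ (m ∈ ⟦ φ ⟧ × m ∈ ⟦ ψ ⟧)
  ∈-∧ₓ (φ ⟨x, b ⟩) (ψ ⟨x, c ⟩) {m}
    with eq ← Sat-∧ M id (m ∷ []) (φ ⟨ b ⟩) (ψ ⟨ c ⟩)
    rewrite map-id b | map-id c | map-id (b ++ c) = eq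

-- Morley sequences of a type finitely satisfiable in M₀

module _ (em : ∀ a → ExcludedMiddle a) {L : Language ℓ} (cL : CountableLanguage L)
         (M : Structure L) (saturated : Saturated M) (uncountable : ¬ Countable ∣ M ∣)
         (M₀ : ElementarySubstructure M) (cM₀ : Countable ∣ structure M₀ ∣)
         (p : CompleteType M U) (finsat : FinitelySatisfiableIn p M₀) where

  private
    ι : ∣ structure M₀ ∣ → ∣ M ∣
    ι = incl M₀

    Formula₀ : ℕ → Set ℓ
    Formula₀ = ParamFormula L ∣ structure M₀ ∣

    countable-Formula₀ : Countable (Formula₀ n)
    countable-Formula₀ = countable-ParamFormula cL cM₀

  decide : ∀ φ → φ ∈ formulas p ⊎ negₓ φ ∈ formulas p
  decide φ = CompleteType.complete p φ (VecAll.universal (λ _ → tt) (params φ))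

  ∧ₓ-closed : ∀ φ ψ → φ ∈ formulas p → ψ ∈ formulas p → _∧ₓ_ M φ ψ ∈ formulas p
  ∧ₓ-closed φ ψ hφ hψ with decide (_∧ₓ_ M φ ψ)
  ... | inj₁ h = h
  ... | inj₂ h with CompleteType.consistent p (φ ∷ ψ ∷ negₓ (_∧ₓ_ M φ ψ) ∷ []) (hφ ∷ hψ ∷ h ∷ [])
  ... | _ , q ∷ r ∷ ¬qr ∷ [] = contradiction (from (∈-∧ₓ M φ ψ) (q , r)) ¬qr

  -- Otherwise φ ∧ ¬ψ would be in p and hold at a point of M₀. Membership in p therefore depends
  -- only on the trace on M₀, which makes p invariant over M₀.
  trace-monotone : ∀ φ ψ → (∀ m → ι m ∈ ⟦ φ ⟧ → ι m ∈ ⟦ ψ ⟧) →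
                   φ ∈ formulas p → ψ ∈ formulas p
  trace-monotone φ ψ φ⊆ψ hφ with decide ψ
  ... | inj₁ h = h
  ... | inj₂ h with finsat (_∧ₓ_ M φ (negₓ ψ)) (∧ₓ-closed φ (negₓ ψ) hφ h)
  ... | m , q = let qφ , q¬ψ = to (∈-∧ₓ M φ (negₓ ψ)) q in contradiction (φ⊆ψ m qφ) q¬ψ

  M₀∪ : Vec ∣ M ∣ n → Pred ∣ M ∣ ℓ
  M₀∪ a x = (∃ λ m → ι m ≡ x) ⊎ (∃ λ i → lookup a i ≡ x)

  in-M₀∪ : (a : Vec ∣ M ∣ n) (b : Vec ∣ structure M₀ ∣ k) →
           VecAll.All (_∈ M₀∪ a) (a ++ Vec.map ι b)
  in-M₀∪ a b = VecAll.++⁺ (VecAll.lookup⁻ λ i → inj₂ (i , refl))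
                          (VecAll.map⁺ (VecAll.universal (λ m → inj₁ (m , refl)) b))

  -- The realisations of the restriction of p to M₀ and the entries of a.
  Generic : Vec ∣ M ∣ n → Pred ∣ M ∣ ℓ
  Generic a c = ∀ φ → φ ∈ formulas p → ParamsIn (M₀∪ a) φ → c ∈ ⟦ φ ⟧

  Generic-antitone : (a : Vec ∣ M ∣ m) (b : Vec ∣ M ∣ n) →
                     (∀ i → ∃ λ j → lookup b j ≡ lookup a i) → Generic b ⊆ Generic a
  Generic-antitone a b a⊆b h φ hφ par = h φ hφ (VecAll.map M₀∪a⊆M₀∪b par)
    where
    M₀∪a⊆M₀∪b : M₀∪ a ⊆ M₀∪ b
    M₀∪a⊆M₀∪b (inj₁ m)         = inj₁ m
    M₀∪a⊆M₀∪b (inj₂ (i , eq)) = let j , eq′ = a⊆b i in inj₂ (j , trans eq′ eq)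

  -- The parameters form the range of a sequence, so saturation applies to the restriction of p to
  -- them.
  generic : (a : Vec ∣ M ∣ n) → ∃ (Generic a)
  generic {n} a = proj₁ realised , λ φ hφ par →
    proj₂ realised φ (VecAll.map M₀∪a⊆Range par , hφ)
    where
    I : Set ℓ
    I = ∣ structure M₀ ∣ ⊎ Fin n

    enumeration : Σ (ℕ → I) λ e → ∀ i → i ∈ Range e
    enumeration = enumerate em (countable-⊎ cM₀ countable-Fin)
                    (inj₁ (Structure.nonempty (structure M₀)))

    s : ℕ → ∣ M ∣
    s = [ ι , lookup a ]′ ∘ proj₁ enumeration

    M₀∪a⊆Range : M₀∪ a ⊆ Range s
    M₀∪a⊆Range (inj₁ (m , eq)) = let n , eq′ = proj₂ enumeration (inj₁ m)
                                 in n , trans (cong [ ι , lookup a ]′ eq′) eq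
    M₀∪a⊆Range (inj₂ (i , eq)) = let n , eq′ = proj₂ enumeration (inj₂ i)
                                 in n , trans (cong [ ι , lookup a ]′ eq′) eq

    p↾Range : CompleteType M (Range s)
    p↾Range .CompleteType.formulas φ = ParamsIn (Range s) φ × φ ∈ formulas p
    p↾Range .CompleteType.over φ = proj₁
    p↾Range .CompleteType.consistent Γ h = CompleteType.consistent p Γ (All.map proj₂ h)
    p↾Range .CompleteType.complete φ par with decide φ
    ... | inj₁ h = inj₁ (par , h)
    ... | inj₂ h = inj₂ (par , h)

    realised : ∃ λ c → Realises c p↾Range
    realised = saturated (Range s) (Smaller-Range em cL M saturated uncountable s) p↾Range

  infix 4 _⊨tp_

  -- An inclusion of types over M₀ is already an equality, since types are closed under taking the
  -- negation of what fails.
  _⊨tp_ : Vec ∣ M ∣ n → Vec ∣ M ∣ n → Set ℓ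
  a ⊨tp e = ∀ F → Sat M ι e F → Sat M ι a F

  ⊨tp-sym : {a e : Vec ∣ M ∣ n} → a ⊨tp e → e ⊨tp a
  ⊨tp-sym h F q = by-contradiction em λ ¬q → h (¬ₚ F) ¬q q

  -- As a and e have the same type over M₀, the formulas φ(x, e) and φ(x, a) have the same trace on
  -- M₀. So if the first is in p, the second is too.
  ⊨tp-extend : {a e : Vec ∣ M ∣ n} {c d : ∣ M ∣} →
               a ⊨tp e → c ∈ Generic a → d ∈ Generic e → (c ∷ a) ⊨tp (d ∷ e)
  ⊨tp-extend {a = a} {e} {c} {d} a⊨e c-gen d-gen F@(φ ⟨ b ⟩) q
    with decide (φ ⟨x, e ++ Vec.map ι b ⟩)
  ... | inj₂ h = contradiction q (d-gen _ h (in-M₀∪ e b))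
  ... | inj₁ h = c-gen _
    (trace-monotone (φ ⟨x, e ++ Vec.map ι b ⟩) (φ ⟨x, a ++ Vec.map ι b ⟩) transfer h) (in-M₀∪ a b)
    where
    transfer : ∀ m → M ⊨ φ [ ι m ∷ e ++ Vec.map ι b ] → M ⊨ φ [ ι m ∷ a ++ Vec.map ι b ]
    transfer m = to (Sat-specialise M ι a m F) ∘ a⊨e (specialise m F) ∘
                 from (Sat-specialise M ι e m F)

  Morley : Vec ∣ M ∣ n → Set ℓ
  Morley []      = Lift ℓ ⊤
  Morley (c ∷ a) = c ∈ Generic a × Morley a

  -- Together with `Morley-pick` this gives the indiscernibility that the NIP argument uses.
  Morley⇒⊨tp : (a e : Vec ∣ M ∣ n) → Morley a → Morley e → a ⊨tp e
  Morley⇒⊨tp []      []      _             _             = λ _ q → q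
  Morley⇒⊨tp (c ∷ a) (d ∷ e) (c-gen , ha) (d-gen , he) =
    ⊨tp-extend (Morley⇒⊨tp a e ha he) c-gen d-gen

  -- Passing to a subsequence only shrinks the set over which each term has to be generic.
  Morley-pick : ∀ w n (a : Vec ∣ M ∣ (n * 2)) → Morley a → Morley (pick w n a)
  Morley-pick w zero    []            _                        = _
  Morley-pick w (suc n) (c₁ ∷ c₀ ∷ a) (c₁-gen , c₀-gen , ha) = head (w n) , Morley-pick w n a ha
    where
    head : ∀ t → (if t then c₀ else c₁) ∈ Generic (pick w n a)
    head true  = Generic-antitone (pick w n a) a (pick-⊆ w n a) c₀-gen
    head false = Generic-antitone (pick w n a) (c₀ ∷ a)
      (λ i → let j , eq = pick-⊆ w n a i in suc j , eq) c₁-gen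

  morley : ∀ n → Vec ∣ M ∣ n
  morley zero    = []
  morley (suc n) = proj₁ (generic (morley n)) ∷ morley n

  Morley-morley : ∀ n → Morley (morley n)
  Morley-morley zero    = _
  Morley-morley (suc n) = proj₂ (generic (morley n)) , Morley-morley n

  -- The bound on alternation

  module _ (φ : Formula L (suc k)) where

    -- That some b realises the pattern along e is one formula about e, hence part of its type; b
    -- itself may change.
    ⊨tp-Pattern : ∀ {w} {a e : Vec ∣ M ∣ n} {b} → a ⊨tp e →
                  Pattern φ w M e b → ∃ (Pattern φ w M a)
    ⊨tp-Pattern {n} {w} {a} {e} {b} a⊨e h =
      let b′ , q = to (⊨-∃̇^ M k matrix) (a⊨e (∃̇^ k matrix ⟨ [] ⟩)
                      (from (⊨-∃̇^ M k matrix) (b , from (⊨-matrix e b) h)))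
      in b′ , to (⊨-matrix a b′) q
      where
      matrix : Formula L (k + (n + 0))
      matrix = patternᶠ φ w n (λ i → k ↑ʳ (i ↑ˡ 0)) (_↑ˡ (n + 0))
      ⊨-matrix : ∀ a b → (M ⊨ matrix [ b ++ (a ++ []) ]) ⇔ Pattern φ w M a b
      ⊨-matrix a b = ⊨-patternᶠ φ w M a b
        (λ i → trans (lookup-++ʳ b (a ++ []) (i ↑ˡ 0)) (lookup-++ˡ a [] i))
        (lookup-++ˡ b (a ++ []))

    Pattern-morley : ∀ {w b} n → Pattern φ w M (morley n) b → ∀ {i} → i < n →
                     M ⊨ literal (w i) φ [ proj₁ (generic (morley i)) ∷ b ]
    Pattern-morley (suc n) (q , qs) (s≤s i≤n) with m≤n⇒m<n∨m≡n i≤n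
    ... | inj₁ i<n  = Pattern-morley n qs i<n
    ... | inj₂ refl = q

    -- Only the type of the sequence a over M₀ is prescribed. This leaves room to extend a by an
    -- element generic over b as well, and makes the condition on b a projection of a type-definable
    -- one.
    Alternates : ℕ → Pred (Vec ∣ M ∣ k) ℓ
    Alternates n b = ∃ λ a → a ⊨tp morley n × Pattern φ alternating M a b

    -- By indiscernibility, picking one element from each pair of consecutive terms turns a
    -- long alternation into an arbitrary pattern on an initial segment of the Morley sequence.
    alternation-bounded : NIP M → ∀ b → ¬ (∀ n → Alternates n b)
    alternation-bounded nip b alternates = nip
      (1 , k , φ , (λ i → e i ∷ []) , (λ w → proj₁ (shattered w)) ,
      λ i w → ⇔-sym (to (⊨-literal M (w i) φ) (proj₂ (shattered w) i)))
      where
      e : ℕ → ∣ M ∣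
      e i = proj₁ (generic (morley i))

      initial : ∀ w n → ∃ (Pattern φ w M (morley n))
      initial w n =
        -- The alternation moves from a to the Morley sequence of length 2n, becomes the pattern w
        -- on a subsequence, and moves from there to the initial segment of length n.
        let a , a⊨ , q = alternates (n * 2)
            b′ , q′ = ⊨tp-Pattern (⊨tp-sym a⊨) q
        in ⊨tp-Pattern (Morley⇒⊨tp (morley n) (pick w n (morley (n * 2))) (Morley-morley n)
                          (Morley-pick w n (morley (n * 2)) (Morley-morley (n * 2))))
                       (Pattern-pick M φ w n (morley (n * 2)) q′)

      φ[_] : ℕ → Bool → ParamFormula L ℕ k
      φ[ i ] t = rename (λ { zero → k ↑ʳ zero ; (suc j) → j ↑ˡ 1 }) (literal t φ) ⟨ i ∷ [] ⟩

      Sat-φ : ∀ i t b → Sat M e b (φ[ i ] t) ⇔ (M ⊨ literal t φ [ e i ∷ b ])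
      Sat-φ i t b = ⊨-rename M
        (λ { zero → lookup-++ʳ b (e i ∷ []) zero ; (suc j) → lookup-++ˡ b (e i ∷ []) j }) (literal t φ)

      shattered : ∀ w → ∃ λ b → ∀ i → M ⊨ literal (w i) φ [ e i ∷ b ]
      shattered w =
        -- The initial segments have separate witnesses; compactness provides one b for the whole
        -- pattern.
        let b , h = realiseℕ em cL M saturated uncountable countable-ℕ e k (λ i → φ[ i ] (w i)) λ n →
              let b , q = initial w (suc n) in
              b , λ i i≤n → from (Sat-φ i (w i) b) (Pattern-morley (suc n) q (s≤s i≤n))
        in b , λ i → to (Sat-φ i (w i) b) (h i)

    -- The empty alternation always exists, so if every length led to the next, all lengths would
    -- occur, against the bound.
    last-alternation : NIP M → ∀ b → ∃ λ n → Alternates n b × ¬ Alternates (suc n) b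
    last-alternation nip b = by-contradiction em λ ∄ → alternation-bounded nip b λ n →
      all-alternate ∄ n
      where
      all-alternate : ¬ (∃ λ n → Alternates n b × ¬ Alternates (suc n) b) → ∀ n → Alternates n b
      all-alternate ∄ zero    = [] , (λ _ q → q) , _
      all-alternate ∄ (suc n) = by-contradiction em λ ¬q → ∄ (n , all-alternate ∄ n , ¬q)

    -- The new element is generic over a and b together: over a to continue the type, over b to
    -- satisfy the formula in p.
    alternation-extends : ∀ {n b} (a : Vec ∣ M ∣ n) → a ⊨tp morley n →
                          Pattern φ alternating M a b →
                          literal (alternating n) φ ⟨x, b ⟩ ∈ formulas p →
                          ∃ λ c → (c ∷ a) ⊨tp morley (suc n) × Pattern φ alternating M (c ∷ a) b
    alternation-extends {n} {b} a a⊨ q h with generic (a ++ b)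
    ... | c , c-gen = c ,
      ⊨tp-extend a⊨ (Generic-antitone a (a ++ b) (λ i → i ↑ˡ k , lookup-++ˡ a b i) c-gen)
                 (proj₂ (generic (morley n))) ,
      c-gen (literal (alternating n) φ ⟨x, b ⟩) h
        (VecAll.lookup⁻ λ j → inj₂ (n ↑ʳ j , lookup-++ʳ a b j)) ,
      q

  -- This lists the type of e over M₀ by all formulas, a countable index type, in place of those
  -- true of e.
  determine : Vec ∣ M ∣ n → Formula₀ n → Formula₀ n
  determine e F with em ℓ {Sat M ι e F}
  ... | yes _ = F
  ... | no _  = ¬ₚ F

  Sat-determine : (e : Vec ∣ M ∣ n) → ∀ F → Sat M ι e (determine e F)
  Sat-determine e F with em ℓ {Sat M ι e F}
  ... | yes q = q
  ... | no ¬q = ¬q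

  ⊨tp⇔determine : {a : Vec ∣ M ∣ n} (e : Vec ∣ M ∣ n) →
                  (a ⊨tp e) ⇔ (∀ F → Sat M ι a (determine e F))
  ⊨tp⇔determine {a = a} e = mk⇔ (λ h F → h (determine e F) (Sat-determine e F)) bwd
    where
    bwd : (∀ F → Sat M ι a (determine e F)) → a ⊨tp e
    bwd h F q with em ℓ {Sat M ι e F} | h F
    ... | yes _ | q′ = q′
    ... | no ¬q | _  = contradiction q ¬q

  -- Refutation of alternations, and the closed pieces

  module _ (φ : Formula L (suc k)) where

    -- Unlike the failure of `Alternates`, this is expressed by a single formula in b over M₀.
    Refutes : Formula₀ n → Pred (Vec ∣ M ∣ k) ℓ
    Refutes {n} F b = ¬ (∃ λ (a : Vec ∣ M ∣ n) → Sat M ι a F × Pattern φ alternating M a b)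

    -- If no formula in the type of `morley n` refuted, this type would be finitely satisfiable
    -- together with the alternation for b, and a realisation would be an alternation of length n.
    refutation : ∀ n b → ¬ Alternates φ n b → ∃ λ F → Sat M ι (morley n) F × Refutes F b
    refutation n b ¬alt = by-contradiction em λ ∄ →
      let a , h = realise em cL M saturated uncountable countable-Formula₀
                    (countable-⊎ cM₀ (countable-Fin {n = k})) f G λ Fs →
              let a , q , r = unrefuted ∄ (⋀ (List.map (determine (morley n)) Fs))
                    (from (Sat-⋀ M ι (morley n) _)
                          (All.map⁺ (All.universal (Sat-determine (morley n)) Fs)))
              in a , All.map (λ {F} q → from (Sat-G a F) (q , r)) (All.map⁻ (to (Sat-⋀ M ι a _) q))
      in ¬alt (a , from (⊨tp⇔determine (morley n)) (λ F → proj₁ (to (Sat-G a F) (h F))) ,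
               proj₂ (to (Sat-G a ⊤ₚ) (h ⊤ₚ)))
      where
      f : ∣ structure M₀ ∣ ⊎ Fin k → ∣ M ∣
      f = [ ι , lookup b ]′

      alternationₚ : ParamFormula L (∣ structure M₀ ∣ ⊎ Fin k) n
      alternationₚ = patternᶠ φ alternating n (_↑ˡ k) (n ↑ʳ_) ⟨ tabulate inj₂ ⟩

      -- The alternation is conjoined to each formula of the type, so that one index type covers
      -- both; any index, such as `⊤ₚ`, gives it back.
      G : Formula₀ n → ParamFormula L (∣ structure M₀ ∣ ⊎ Fin k) n
      G F = mapₚ inj₁ (determine (morley n) F) ∧ₚ alternationₚ

      Sat-alternationₚ : ∀ a → Sat M f a alternationₚ ⇔ Pattern φ alternating M a b
      Sat-alternationₚ a = ⊨-patternᶠ φ alternating M a b (lookup-++ˡ a _) λ j →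
        trans (lookup-++ʳ a (Vec.map f (tabulate inj₂)) j)
        (trans (lookup-map j f (tabulate inj₂)) (cong f (lookup∘tabulate inj₂ j)))

      Sat-G : ∀ a F → Sat M f a (G F) ⇔
                        (Sat M ι a (determine (morley n) F) × Pattern φ alternating M a b)
      Sat-G a F = mk⇔
        (λ q → let q₁ , q₂ = to (Sat-∧ M f a (mapₚ inj₁ D) alternationₚ) q in
               subst id (Sat-mapₚ M f inj₁ a D) q₁ , to (Sat-alternationₚ a) q₂)
        (λ (q₁ , q₂) → from (Sat-∧ M f a (mapₚ inj₁ D) alternationₚ)
               (subst id (sym (Sat-mapₚ M f inj₁ a D)) q₁ , from (Sat-alternationₚ a) q₂))
        where D = determine (morley n) F

      unrefuted : ¬ (∃ λ F → Sat M ι (morley n) F × Refutes F b) →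
                  ∀ F → Sat M ι (morley n) F → ∃ λ a → Sat M ι a F × Pattern φ alternating M a b
      unrefuted ∄ F q = by-contradiction em λ ¬q → ∄ (F , q , ¬q)

    -- At odd n the value due next is false. If ¬φ(x, b) were in p, the alternation could be
    -- continued by it, and the longer sequence, having the type of `morley (suc n)`, would satisfy
    -- F.
    stops-alternating⇒∈p : ∀ {n b} F → alternating n ≡ false → Sat M ι (morley (suc n)) F →
                           Alternates φ n b → Refutes F b → φ ⟨x, b ⟩ ∈ formulas p
    stops-alternating⇒∈p {n} {b} F even F-morley (a , a⊨ , q) refutes with decide (φ ⟨x, b ⟩)
    ... | inj₁ h = h
    ... | inj₂ h =
      let c , ca⊨ , cq = alternation-extends φ a a⊨ q
                           (subst (λ t → literal t φ ⟨x, b ⟩ ∈ formulas p) (sym even) h)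
      in contradiction (c ∷ a , ca⊨ F F-morley , cq) refutes

    -- A last alternation cannot be due to continue with true, because φ(x, b) in p would supply the
    -- next term.
    ∈p⇒stops-alternating : NIP M → ∀ b → φ ⟨x, b ⟩ ∈ formulas p →
                           ∃ λ n → alternating n ≡ false × Alternates φ n b ×
                             ∃ λ F → Sat M ι (morley (suc n)) F × Refutes F b
    ∈p⇒stops-alternating nip b h =
      let n , (a , a⊨ , q) , ¬alt = last-alternation φ nip b
      in n , stops-at-false a a⊨ q ¬alt (alternating n) refl , (a , a⊨ , q) ,
         refutation (suc n) b ¬alt
      where
      stops-at-false : ∀ {n} (a : Vec ∣ M ∣ n) → a ⊨tp morley n → Pattern φ alternating M a b →
                       ¬ Alternates φ (suc n) b → ∀ t → alternating n ≡ t → alternating n ≡ false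
      stops-at-false a a⊨ q ¬alt false eq = eq
      stops-at-false a a⊨ q ¬alt true  eq =
        let c , alt = alternation-extends φ a a⊨ q
                        (subst (λ t → literal t φ ⟨x, b ⟩ ∈ formulas p) (sym eq) h)
        in contradiction (c ∷ a , alt) ¬alt

    module _ (n : ℕ) (F : Formula₀ (suc n)) where

      Piece : Pred (2^ ∣ structure M₀ ∣) ℓ
      Piece χ = ∃ λ b → Alternates φ n b × Refutes F b × (∀ m → (m ∈₂ χ) ⇔ (M ⊨ φ [ ι m ∷ b ]))

      -- Joining the witness a to b gives a tuple of n + k variables, on which the type of a over M₀
      -- is a countable list of formulas and the remaining conditions form one formula, `base`.
      Closed-Piece : Closed Piece
      Closed-Piece χ χ∉ =
        let ms , h = Closed-traces em cL M saturated uncountable M₀ cM₀ countable-Formula₀ G E χ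
                       (χ∉ ∘ to (reformulate χ))
        in ms , λ χ′ agree → h χ′ agree ∘ from (reformulate χ′)
        where
        alternation : Formula L (n + k + size F)
        alternation = patternᶠ φ alternating n (λ i → (i ↑ˡ k) ↑ˡ size F) (λ j → (n ↑ʳ j) ↑ˡ size F)

        -- The context holds the sequence to be excluded, then a and b, then the constants of F.
        matrix : Formula L (suc n + (n + k + size F))
        matrix = rename (Fin.lift (suc n) ((n + k) ↑ʳ_)) (body F) ∧̇
          patternᶠ φ alternating (suc n) (_↑ˡ (n + k + size F)) (λ j → suc n ↑ʳ ((n ↑ʳ j) ↑ˡ size F))

        base : Formula₀ (n + k)
        base = (alternation ∧̇ ¬̇ ∃̇^ (suc n) matrix) ⟨ constants F ⟩

        G : Formula₀ n → Formula₀ (n + k)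
        G D = renameₚ (_↑ˡ k) (determine (morley n) D) ∧ₚ base

        E : Formula₀ (suc (n + k))
        E = rename (Fin.lift 1 λ j → (n ↑ʳ j) ↑ˡ 0) φ ⟨ [] ⟩

        module _ (a : Vec ∣ M ∣ n) (b : Vec ∣ M ∣ k) where

          c : Vec ∣ M ∣ (size F)
          c = Vec.map ι (constants F)

          lookup-a : ∀ i → lookup ((a ++ b) ++ c) ((i ↑ˡ k) ↑ˡ size F) ≡ lookup a i
          lookup-a i = trans (lookup-++ˡ (a ++ b) c (i ↑ˡ k)) (lookup-++ˡ a b i)

          lookup-b : ∀ j → lookup ((a ++ b) ++ c) ((n ↑ʳ j) ↑ˡ size F) ≡ lookup b j
          lookup-b j = trans (lookup-++ˡ (a ++ b) c (n ↑ʳ j)) (lookup-++ʳ a b j)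

          ⊨-alternation : (M ⊨ alternation [ (a ++ b) ++ c ]) ⇔ Pattern φ alternating M a b
          ⊨-alternation = ⊨-patternᶠ φ alternating M a b lookup-a lookup-b

          ⊨-matrix : ∀ a′ → (M ⊨ matrix [ a′ ++ ((a ++ b) ++ c) ]) ⇔
                            (Sat M ι a′ F × Pattern φ alternating M a′ b)
          ⊨-matrix a′ =
            ⊨-rename M (lookup-lift a′ (lookup-++ʳ (a ++ b) c)) (body F) ×-⇔
            ⊨-patternᶠ φ alternating M a′ b (lookup-++ˡ a′ _) λ j →
              trans (lookup-++ʳ a′ ((a ++ b) ++ c) ((n ↑ʳ j) ↑ˡ size F)) (lookup-b j)

          Sat-base : Sat M ι (a ++ b) base ⇔ (Pattern φ alternating M a b × Refutes F b)
          Sat-base = ⊨-alternation ×-⇔ mk⇔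
            (λ h (a′ , q) → h (from (⊨-∃̇^ M (suc n) matrix) (a′ , from (⊨-matrix a′) q)))
            (λ h q → let a′ , q′ = to (⊨-∃̇^ M (suc n) matrix) q in h (a′ , to (⊨-matrix a′) q′))

          Sat-G : (∀ D → Sat M ι (a ++ b) (G D)) ⇔
                  ((a ⊨tp morley n) × (Pattern φ alternating M a b × Refutes F b))
          Sat-G = mk⇔
            (λ h → from (⊨tp⇔determine (morley n)) (λ D → proj₁ (to (Sat-GD D) (h D))) ,
                   proj₂ (to (Sat-GD ⊤ₚ) (h ⊤ₚ)))
            (λ (a⊨ , q) D → from (Sat-GD D) (to (⊨tp⇔determine (morley n)) a⊨ D , q))
            where
            Sat-GD : ∀ D → Sat M ι (a ++ b) (G D) ⇔
                     (Sat M ι a (determine (morley n) D) ×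
                       (Pattern φ alternating M a b × Refutes F b))
            Sat-GD D =
              (Sat-rename M ι {v = a} {w = a ++ b} (lookup-++ˡ a b) (determine (morley n) D)
                 ×-⇔ Sat-base)
              ⇔-∘ Sat-∧ M ι (a ++ b) (renameₚ (_↑ˡ k) (determine (morley n) D)) base

          Sat-E : ∀ x → Sat M ι (x ∷ a ++ b) E ⇔ (M ⊨ φ [ x ∷ b ])
          Sat-E x = ⊨-rename M (lookup-lift (x ∷ []) λ j →
            trans (lookup-++ˡ (a ++ b) [] (n ↑ʳ j)) (lookup-++ʳ a b j)) φ

        Projection : Pred (2^ ∣ structure M₀ ∣) ℓ
        Projection χ = ∃ λ v → (∀ D → Sat M ι v (G D)) × (∀ m → (m ∈₂ χ) ⇔ Sat M ι (ι m ∷ v) E)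

        reformulate : ∀ χ → (χ ∈ Projection) ⇔ (χ ∈ Piece)
        reformulate χ = mk⇔ fwd λ (b , (a , a⊨ , q) , r , h) →
          a ++ b , from (Sat-G a b) (a⊨ , q , r) , λ m → ⇔-sym (Sat-E a b (ι m)) ⇔-∘ h m
          where
          fwd : χ ∈ Projection → χ ∈ Piece
          fwd (v , hG , hE) with Vec.splitAt n v
          ... | a , b , refl = let a⊨ , q , r = to (Sat-G a b) hG in
            b , (a , a⊨ , q) , r , λ m → Sat-E a b (ι m) ⇔-∘ hE m

  Fσ-Traces-uncountable : NIP M → Fσ (Traces p M₀)
  -- The default index contributes the empty set, because 0 is not odd.
  Fσ-Traces-uncountable nip = Fσ-⋃ em countable-J (0 , ⊤̇ , 0 , ⊤ₚ) C closed λ χ → mk⇔ fwd bwd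
    where
    J : Set ℓ
    J = ∃ λ k → Formula L (suc k) × ∃ λ n → Formula₀ (suc n)

    countable-J : Countable J
    countable-J = countable-Σ countable-ℕ λ _ → countable-× (countable-Formula cL)
                    (countable-Σ countable-ℕ λ _ → countable-Formula₀)

    C : J → Pred (2^ ∣ structure M₀ ∣) ℓ
    C (k , φ , n , F) χ = (alternating n ≡ false × Sat M ι (morley (suc n)) F) × χ ∈ Piece φ n F

    closed : ∀ j → Closed (C j)
    closed (k , φ , n , F) = Closed-× em (Closed-Piece φ n F)

    fwd : ∀ {χ} → χ ∈ Traces p M₀ → ∃ λ j → χ ∈ C j
    fwd ((φ ⟨x, b ⟩) , h , tr) =
      let n , even , alt , F , F-morley , r = ∈p⇒stops-alternating φ nip b h
      in (_ , φ , n , F) , (even , F-morley) , b , alt , r , tr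

    bwd : ∀ {χ} → (∃ λ j → χ ∈ C j) → χ ∈ Traces p M₀
    bwd ((_ , φ , n , F) , (even , F-morley) , b , alt , r , tr) =
      (φ ⟨x, b ⟩) , stops-alternating⇒∈p φ F even F-morley alt r , tr

theorem3p5 : (∀ a → ExcludedMiddle a) →
    {ℓ : Level} (L : Language ℓ) → CountableLanguage L →
    (T : Theory L) → CompleteTheory T →
    (M : Structure L) → M ⊨ᵀ T → Saturated M → NIP M →
    (M₀ : ElementarySubstructure M) → Countable ∣ structure M₀ ∣ →
    (p : CompleteType M U) → FinitelySatisfiableIn p M₀ →
    Borel (Traces p M₀) × Fσ (Traces p M₀)
theorem3p5 em {ℓ} L cL T complete M M⊨T saturated nip M₀ cM₀ p finsat = Fσ⇒Borel em fσ , fσ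
  where
  fσ : Fσ (Traces p M₀)
  -- If M is countable, M₀ may be as large as M, and saturation need not realise types over it.
  fσ with em ℓ {Countable ∣ M ∣}
  ... | yes cM = Fσ-Traces-countable em cL M cM p M₀
  ... | no ¬cM = Fσ-Traces-uncountable em cL M saturated ¬cM M₀ cM₀ p finsat nip
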